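{- (In LZFC.) Let $M$ be a strongly extendible model. Then: (i) $M\prec_{\Sigma_1} V$. Therefore, in ${\rm LZFC}^{sext}$ every set belongs to some model $M$ with $M\prec_{\Sigma_1} V$. (ii) Actually $M\prec_{\Sigma_2}V$.
   Context: All theories are in the language $\{\in\}$. BST is the theory with axioms: Empty set, Extensionality, Pair, Union, Cartesian Product, "$\omega$ exists", $\Delta_0$-Separation. $Loc({\rm ZFC})$ is the statement that every set belongs to a transitive model of ZFC; ${\rm LZFC}={\rm BST}+Loc({\rm ZFC})$. "Model" means a (set) transitive model of ZFC. A model $M$ is strongly extendible if for every set $x$ there is a model $N$ such that $x\in N$ and $M\prec N$. $Loc^{sext}({\rm ZFC})$ says that every set belongs to a strongly extendible model, and ${\rm LZFC}^{sext}={\rm LZFC}+Loc^{sext}({\rm ZFC})$. A $\Sigma_n$ formula is one of the form $(\exists \overline{x}_1)(\forall \overline{x}_2)\cdots (Q \overline{x}_n)\psi$ with $\psi$ bounded and the $\overline{x}_i$ tuples of variables. $M\prec_{\Sigma_n}V$ means that for every $\Sigma_n$ sentence $\phi$ with parameters from $M$, $M\models\phi$ iff $\phi$ is true in the universe $V$. -}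

module Defs where

open import Data.Fin using (Fin; toℕ; fromℕ; inject₁; #_)
open import Data.List using (List; []; _∷_)
open import Data.List.Relation.Unary.All using () renaming (All to Allᴸ)
open import Data.Nat using (ℕ; zero; suc)
open import Data.Product using (Σ; ∃; ∃₂; ∃-syntax; _×_; _,_; proj₁; proj₂)
open import Data.Sum using (_⊎_)
open import Data.Vec using (Vec; []; lookup; init; last; _∷ʳ_)
open import Data.Vec.Relation.Unary.All using (All)
open import Function.Bundles using (_⇔_)
open import Level using (Level) renaming (suc to lsuc)
open import Relation.Binary.PropositionalEquality using (_≡_)
open import Relation.Nullary using (¬_)

infix  9 ∀̇_ ∃̇_ ¬̇_
infix  8 _∈̇_ _≐_
infixr 7 _∧̇_
infixr 6 _∨̇_
infixr 5 _⇒̇_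
infix  4 _⇔̇_

-- Formulas of the language {∈} with free variables v₀, …, v_{n-1}.
-- Variables are de Bruijn *levels*: a quantifier in front of a formula of
-- Fm (suc n) binds the last variable vₙ.
data Fm (n : ℕ) : Set where
  _∈̇_ _≐_         : Fin n → Fin n → Fm n
  ¬̇_              : Fm n → Fm n
  _∧̇_ _∨̇_ _⇒̇_   : Fm n → Fm n → Fm n
  ∀̇_ ∃̇_          : Fm (suc n) → Fm n

_⇔̇_ : ∀ {n} → Fm n → Fm n → Fm n
φ ⇔̇ ψ = (φ ⇒̇ ψ) ∧̇ (ψ ⇒̇ φ)

-- In the last two clauses fromℕ n is the variable being bound and
-- inject₁ i, the bound of the quantifier, is any other variable.
data Δ₀ {n : ℕ} : Fm n → Set where
  mem₀  : ∀ i j → Δ₀ (i ∈̇ j)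
  eq₀   : ∀ i j → Δ₀ (i ≐ j)
  neg₀  : ∀ {φ} → Δ₀ φ → Δ₀ (¬̇ φ)
  and₀  : ∀ {φ ψ} → Δ₀ φ → Δ₀ ψ → Δ₀ (φ ∧̇ ψ)
  or₀   : ∀ {φ ψ} → Δ₀ φ → Δ₀ ψ → Δ₀ (φ ∨̇ ψ)
  imp₀  : ∀ {φ ψ} → Δ₀ φ → Δ₀ ψ → Δ₀ (φ ⇒̇ ψ)
  ball₀ : ∀ (i : Fin n) {φ : Fm (suc n)} → Δ₀ φ → Δ₀ (∀̇ ((fromℕ n ∈̇ inject₁ i) ⇒̇ φ))
  bex₀  : ∀ (i : Fin n) {φ : Fm (suc n)} → Δ₀ φ → Δ₀ (∃̇ ((fromℕ n ∈̇ inject₁ i) ∧̇ φ))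

-- IsΣ k φ: φ is (∃x̄₁)(∀x̄₂)⋯(Qx̄ₖ)ψ with ψ bounded; dually for IsΠ.  The
-- blocks x̄ᵢ are tuples of any length, including 0.
data IsΣ : ∀ {n} → ℕ → Fm n → Set
data IsΠ : ∀ {n} → ℕ → Fm n → Set

data IsΣ where
  bounded : ∀ {n} {φ : Fm n} → Δ₀ φ → IsΣ 0 φ
  fromΠ   : ∀ {n k} {φ : Fm n} → IsΠ k φ → IsΣ (suc k) φ
  ∃-block : ∀ {n k} {φ : Fm (suc n)} → IsΣ (suc k) φ → IsΣ (suc k) (∃̇ φ)

data IsΠ where
  bounded : ∀ {n} {φ : Fm n} → Δ₀ φ → IsΠ 0 φ
  fromΣ   : ∀ {n k} {φ : Fm n} → IsΣ k φ → IsΠ (suc k) φ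
  ∀-block : ∀ {n k} {φ : Fm (suc n)} → IsΠ (suc k) φ → IsΠ (suc k) (∀̇ φ)

extensionalityᶻ foundationᶻ pairingᶻ unionᶻ powerSetᶻ infinityᶻ choiceᶻ : Fm 0

extensionalityᶻ = ∀̇ ∀̇ ((∀̇ (# 2 ∈̇ # 0 ⇔̇ # 2 ∈̇ # 1)) ⇒̇ # 0 ≐ # 1)

foundationᶻ = ∀̇ ((∃̇ (# 1 ∈̇ # 0)) ⇒̇ (∃̇ (# 1 ∈̇ # 0 ∧̇ ¬̇ (∃̇ (# 2 ∈̇ # 1 ∧̇ # 2 ∈̇ # 0)))))

pairingᶻ = ∀̇ ∀̇ ∃̇ ∀̇ (# 3 ∈̇ # 2 ⇔̇ (# 3 ≐ # 0 ∨̇ # 3 ≐ # 1))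

unionᶻ = ∀̇ ∃̇ ∀̇ (# 2 ∈̇ # 1 ⇔̇ (∃̇ (# 3 ∈̇ # 0 ∧̇ # 2 ∈̇ # 3)))

powerSetᶻ = ∀̇ ∃̇ ∀̇ (# 2 ∈̇ # 1 ⇔̇ (∀̇ (# 3 ∈̇ # 2 ⇒̇ # 3 ∈̇ # 0)))

infinityᶻ = ∃̇ ((∃̇ (# 1 ∈̇ # 0 ∧̇ (∀̇ (¬̇ (# 2 ∈̇ # 1)))))
            ∧̇ (∀̇ (# 1 ∈̇ # 0 ⇒̇
                   (∃̇ (# 2 ∈̇ # 0 ∧̇ (∀̇ (# 3 ∈̇ # 2 ⇔̇ (# 3 ∈̇ # 1 ∨̇ # 3 ≐ # 1))))))))

-- Every family of nonempty pairwise disjoint sets has a transversal.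
choiceᶻ = ∀̇ (((∀̇ (# 1 ∈̇ # 0 ⇒̇ (∃̇ (# 2 ∈̇ # 1))))
              ∧̇ (∀̇ ∀̇ ((# 1 ∈̇ # 0 ∧̇ # 2 ∈̇ # 0 ∧̇ (∃̇ (# 3 ∈̇ # 1 ∧̇ # 3 ∈̇ # 2)))
                         ⇒̇ # 1 ≐ # 2)))
             ⇒̇ (∃̇ ∀̇ (# 2 ∈̇ # 0 ⇒̇
                        (∃̇ ∀̇ ((# 4 ∈̇ # 2 ∧̇ # 4 ∈̇ # 1) ⇔̇ # 4 ≐ # 3)))))

finiteZFC : List (Fm 0)
finiteZFC = extensionalityᶻ ∷ foundationᶻ ∷ pairingᶻ ∷ unionᶻ ∷ powerSetᶻ
          ∷ infinityᶻ ∷ choiceᶻ ∷ []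

record Structure (ℓ : Level) : Set (lsuc ℓ) where
  infix 4 _∈_
  field
    V   : Set ℓ
    _∈_ : V → V → Set ℓ

module Truth {ℓ} (𝒱 : Structure ℓ) where
  open Structure 𝒱

  V⊨_[_] : ∀ {n} → Fm n → Vec V n → Set ℓ
  V⊨ i ∈̇ j [ ρ ]  = lookup ρ i ∈ lookup ρ j
  V⊨ i ≐ j [ ρ ]   = lookup ρ i ≡ lookup ρ j
  V⊨ ¬̇ φ [ ρ ]    = ¬ V⊨ φ [ ρ ]
  V⊨ φ ∧̇ ψ [ ρ ]  = V⊨ φ [ ρ ] × V⊨ ψ [ ρ ]
  V⊨ φ ∨̇ ψ [ ρ ]  = V⊨ φ [ ρ ] ⊎ V⊨ ψ [ ρ ]
  V⊨ φ ⇒̇ ψ [ ρ ]  = V⊨ φ [ ρ ] → V⊨ ψ [ ρ ]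
  V⊨ ∀̇ φ [ ρ ]    = ∀ x → V⊨ φ [ ρ ∷ʳ x ]
  V⊨ ∃̇ φ [ ρ ]    = ∃[ x ] V⊨ φ [ ρ ∷ʳ x ]

  IsEmpty : V → Set ℓ
  IsEmpty e = ∀ x → ¬ x ∈ e

  IsSuc : V → V → Set ℓ
  IsSuc y x = ∀ z → z ∈ y ⇔ (z ∈ x ⊎ z ≡ x)

  IsUPair : V → V → V → Set ℓ
  IsUPair p x y = ∀ z → z ∈ p ⇔ (z ≡ x ⊎ z ≡ y)

  IsOPair : V → V → V → Set ℓ
  IsOPair p x y = ∀ z → z ∈ p ⇔ (IsUPair z x x ⊎ IsUPair z x y)

  Inductive : V → Set ℓ
  Inductive w = (∀ e → IsEmpty e → e ∈ w) × (∀ x y → x ∈ w → IsSuc y x → y ∈ w)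

  IsOmega : V → Set ℓ
  IsOmega w = Inductive w × (∀ u → Inductive u → ∀ x → x ∈ w → x ∈ u)

record BST {ℓ} (𝒱 : Structure ℓ) : Set ℓ where
  open Structure 𝒱
  open Truth 𝒱
  field
    emptySet       : ∃[ e ] IsEmpty e
    extensionality : ∀ x y → (∀ z → z ∈ x ⇔ z ∈ y) → x ≡ y
    pair           : ∀ x y → ∃[ p ] IsUPair p x y
    union          : ∀ a → ∃[ u ] (∀ z → z ∈ u ⇔ (∃[ y ] (y ∈ a × z ∈ y)))
    product        : ∀ a b → ∃[ c ] (∀ z → z ∈ c ⇔
                       (∃₂ λ x y → x ∈ a × y ∈ b × IsOPair z x y))
    omega          : ∃[ w ] IsOmega w
    Δ₀-separation  : ∀ {n} (φ : Fm (suc n)) → Δ₀ φ → ∀ (ρ : Vec V n) a →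
                       ∃[ b ] (∀ x → x ∈ b ⇔ (x ∈ a × V⊨ φ [ ρ ∷ʳ x ]))

-- Satisfaction, models and elementarity *inside* a structure of BST: formulas
-- are coded by sets and every quantifier below ranges over V, so each notion is
-- given by a formula of {∈}.  In particular ω and the set of formulas are those
-- of V, and may be nonstandard.
module Internal {ℓ} {𝒱 : Structure ℓ} (B : BST 𝒱) where
  open Structure 𝒱
  open Truth 𝒱
  open BST B

  ∅ ω : V
  ∅ = proj₁ emptySet
  ω = proj₁ omega

  ｛_،_｝ : V → V → V
  ｛ x ، y ｝ = proj₁ (pair x y)

  ⟨_،_⟩ : V → V → V
  ⟨ x ، y ⟩ = ｛ ｛ x ، x ｝ ، ｛ x ، y ｝ ｝

  _∪_ : V → V → V
  x ∪ y = proj₁ (union ｛ x ، y ｝)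

  _⁺ : V → V
  x ⁺ = x ∪ ｛ x ، x ｝

  numeral : ℕ → V
  numeral zero    = ∅
  numeral (suc n) = numeral n ⁺

  _⊆_ : V → V → Set ℓ
  x ⊆ y = ∀ z → z ∈ x → z ∈ y

  Transitive : V → Set ℓ
  Transitive x = ∀ y → y ∈ x → y ⊆ x

  -- s ∈ ⁿM
  IsAssignment : V → V → V → Set ℓ
  IsAssignment s n M =
      (∀ z → z ∈ s → ∃₂ λ i x → i ∈ n × x ∈ M × z ≡ ⟨ i ، x ⟩)
    × (∀ i → i ∈ n → ∃[ x ] (⟨ i ، x ⟩ ∈ s × (∀ y → ⟨ i ، y ⟩ ∈ s → y ≡ x)))

  -- The extension of s ∈ ⁿM to an assignment of n ⁺ with value x at n.
  _⌢[_↦_] : V → V → V → V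
  s ⌢[ n ↦ x ] = s ∪ ｛ ⟨ n ، x ⟩ ، ⟨ n ، x ⟩ ｝

  memᶜ eqᶜ andᶜ orᶜ impᶜ : V → V → V
  memᶜ i j = ⟨ numeral 0 ، ⟨ i ، j ⟩ ⟩
  eqᶜ  i j = ⟨ numeral 1 ، ⟨ i ، j ⟩ ⟩
  andᶜ φ ψ = ⟨ numeral 2 ، ⟨ φ ، ψ ⟩ ⟩
  orᶜ  φ ψ = ⟨ numeral 3 ، ⟨ φ ، ψ ⟩ ⟩
  impᶜ φ ψ = ⟨ numeral 4 ، ⟨ φ ، ψ ⟩ ⟩

  negᶜ allᶜ exᶜ : V → V
  negᶜ φ = ⟨ numeral 5 ، φ ⟩
  allᶜ φ = ⟨ numeral 6 ، φ ⟩
  exᶜ  φ = ⟨ numeral 7 ، φ ⟩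

  -- ⟨ n ، φ ⟩ ∈ F stands for "φ is a formula in the variables v_i, i ∈ n".
  record FormulaClosed (F : V) : Set ℓ where
    field
      mem : ∀ n → n ∈ ω → ∀ i j → i ∈ n → j ∈ n → ⟨ n ، memᶜ i j ⟩ ∈ F
      eq  : ∀ n → n ∈ ω → ∀ i j → i ∈ n → j ∈ n → ⟨ n ، eqᶜ i j ⟩ ∈ F
      neg : ∀ n → n ∈ ω → ∀ φ → ⟨ n ، φ ⟩ ∈ F → ⟨ n ، negᶜ φ ⟩ ∈ F
      and : ∀ n → n ∈ ω → ∀ φ ψ → ⟨ n ، φ ⟩ ∈ F → ⟨ n ، ψ ⟩ ∈ F → ⟨ n ، andᶜ φ ψ ⟩ ∈ F
      or  : ∀ n → n ∈ ω → ∀ φ ψ → ⟨ n ، φ ⟩ ∈ F → ⟨ n ، ψ ⟩ ∈ F → ⟨ n ، orᶜ φ ψ ⟩ ∈ F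
      imp : ∀ n → n ∈ ω → ∀ φ ψ → ⟨ n ، φ ⟩ ∈ F → ⟨ n ، ψ ⟩ ∈ F → ⟨ n ، impᶜ φ ψ ⟩ ∈ F
      all : ∀ n → n ∈ ω → ∀ φ → ⟨ n ⁺ ، φ ⟩ ∈ F → ⟨ n ، allᶜ φ ⟩ ∈ F
      ex  : ∀ n → n ∈ ω → ∀ φ → ⟨ n ⁺ ، φ ⟩ ∈ F → ⟨ n ، exᶜ φ ⟩ ∈ F

  -- The codes of formulas form the least class closed under the formation
  -- rules.  Under Loc(ZFC) this class is a set (any transitive model of ZFC is
  -- FormulaClosed), so the quantification over sets F suffices.
  Form : V → V → Set ℓ
  Form n φ = ∀ F → FormulaClosed F → ⟨ n ، φ ⟩ ∈ F

  -- S is a satisfaction relation for (M,∈); ⟨ φ ، s ⟩ ∈ S stands for M ⊨ φ[s].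
  -- The number of free variables of φ, and hence which variable an outermost
  -- quantifier binds, is read off from the domain of s.
  record IsSatisfaction (M S : V) : Set ℓ where
    field
      mem : ∀ n → n ∈ ω → ∀ s → IsAssignment s n M → ∀ i j → i ∈ n → j ∈ n →
            ⟨ memᶜ i j ، s ⟩ ∈ S ⇔ (∃₂ λ x y → ⟨ i ، x ⟩ ∈ s × ⟨ j ، y ⟩ ∈ s × x ∈ y)
      eq  : ∀ n → n ∈ ω → ∀ s → IsAssignment s n M → ∀ i j → i ∈ n → j ∈ n →
            ⟨ eqᶜ i j ، s ⟩ ∈ S ⇔ (∃₂ λ x y → ⟨ i ، x ⟩ ∈ s × ⟨ j ، y ⟩ ∈ s × x ≡ y)
      neg : ∀ n → n ∈ ω → ∀ s → IsAssignment s n M → ∀ φ → Form n φ →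
            ⟨ negᶜ φ ، s ⟩ ∈ S ⇔ (¬ ⟨ φ ، s ⟩ ∈ S)
      and : ∀ n → n ∈ ω → ∀ s → IsAssignment s n M → ∀ φ ψ → Form n φ → Form n ψ →
            ⟨ andᶜ φ ψ ، s ⟩ ∈ S ⇔ (⟨ φ ، s ⟩ ∈ S × ⟨ ψ ، s ⟩ ∈ S)
      or  : ∀ n → n ∈ ω → ∀ s → IsAssignment s n M → ∀ φ ψ → Form n φ → Form n ψ →
            ⟨ orᶜ φ ψ ، s ⟩ ∈ S ⇔ (⟨ φ ، s ⟩ ∈ S ⊎ ⟨ ψ ، s ⟩ ∈ S)
      imp : ∀ n → n ∈ ω → ∀ s → IsAssignment s n M → ∀ φ ψ → Form n φ → Form n ψ →
            ⟨ impᶜ φ ψ ، s ⟩ ∈ S ⇔ (⟨ φ ، s ⟩ ∈ S → ⟨ ψ ، s ⟩ ∈ S)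
      all : ∀ n → n ∈ ω → ∀ s → IsAssignment s n M → ∀ φ → Form (n ⁺) φ →
            ⟨ allᶜ φ ، s ⟩ ∈ S ⇔ (∀ x → x ∈ M → ⟨ φ ، s ⌢[ n ↦ x ] ⟩ ∈ S)
      ex  : ∀ n → n ∈ ω → ∀ s → IsAssignment s n M → ∀ φ → Form (n ⁺) φ →
            ⟨ exᶜ φ ، s ⟩ ∈ S ⇔ (∃[ x ] (x ∈ M × ⟨ φ ، s ⌢[ n ↦ x ] ⟩ ∈ S))

  _⊨_[_] : V → V → V → Set ℓ
  M ⊨ φ [ s ] = ∃[ S ] (IsSatisfaction M S × ⟨ φ ، s ⟩ ∈ S)

  ⌜_⌝ : ∀ {n} → Fm n → V
  ⌜ i ∈̇ j ⌝  = memᶜ (numeral (toℕ i)) (numeral (toℕ j))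
  ⌜ i ≐ j ⌝   = eqᶜ (numeral (toℕ i)) (numeral (toℕ j))
  ⌜ ¬̇ φ ⌝    = negᶜ ⌜ φ ⌝
  ⌜ φ ∧̇ ψ ⌝  = andᶜ ⌜ φ ⌝ ⌜ ψ ⌝
  ⌜ φ ∨̇ ψ ⌝  = orᶜ ⌜ φ ⌝ ⌜ ψ ⌝
  ⌜ φ ⇒̇ ψ ⌝  = impᶜ ⌜ φ ⌝ ⌜ ψ ⌝
  ⌜ ∀̇ φ ⌝    = allᶜ ⌜ φ ⌝
  ⌜ ∃̇ φ ⌝    = exᶜ ⌜ φ ⌝

  assignment : ∀ {n} → Vec V n → V
  assignment {zero}  ρ = ∅
  assignment {suc n} ρ = assignment (init ρ) ⌢[ numeral n ↦ last ρ ]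

  -- The schemes range over all formula codes of V, with parameters given by s;
  -- their instances are written out through the satisfaction clauses.
  record SatisfiesZFC (M S : V) : Set ℓ where
    field
      finite      : Allᴸ (λ σ → ⟨ ⌜ σ ⌝ ، ∅ ⟩ ∈ S) finiteZFC
      separation  : ∀ n → n ∈ ω → ∀ φ → Form (n ⁺) φ → ∀ s → IsAssignment s n M →
        ∀ a → a ∈ M → ∃[ b ] (b ∈ M × (∀ x → x ∈ M →
          x ∈ b ⇔ (x ∈ a × ⟨ φ ، s ⌢[ n ↦ x ] ⟩ ∈ S)))
      replacement : ∀ n → n ∈ ω → ∀ φ → Form ((n ⁺) ⁺) φ → ∀ s → IsAssignment s n M →
        let φ⟨_,_⟩ = λ x y → ⟨ φ ، (s ⌢[ n ↦ x ]) ⌢[ n ⁺ ↦ y ] ⟩ ∈ S in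
        ∀ a → a ∈ M →
        (∀ x → x ∈ M → x ∈ a →
          ∃[ y ] (y ∈ M × φ⟨ x , y ⟩ × (∀ z → z ∈ M → φ⟨ x , z ⟩ → z ≡ y))) →
        ∃[ b ] (b ∈ M × (∀ y → y ∈ M →
          y ∈ b ⇔ (∃[ x ] (x ∈ M × x ∈ a × φ⟨ x , y ⟩))))

  Model : V → Set ℓ
  Model M = Transitive M × ∃[ S ] (IsSatisfaction M S × SatisfiesZFC M S)

  _≺_ : V → V → Set ℓ
  M ≺ N = M ⊆ N × (∀ n → n ∈ ω → ∀ φ → Form n φ → ∀ s → IsAssignment s n M →
                    M ⊨ φ [ s ] ⇔ N ⊨ φ [ s ])

  StronglyExtendible : V → Set ℓ
  StronglyExtendible M = Model M × (∀ x → ∃[ N ] (Model N × x ∈ N × M ≺ N))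

  Loc-ZFC : Set ℓ
  Loc-ZFC = ∀ x → ∃[ M ] (Model M × x ∈ M)

  Locˢᵉˣᵗ-ZFC : Set ℓ
  Locˢᵉˣᵗ-ZFC = ∀ x → ∃[ M ] (StronglyExtendible M × x ∈ M)

  -- Truth in V is not definable in V, so k and φ are standard here.
  _≺Σ[_]V : V → ℕ → Set ℓ
  M ≺Σ[ k ]V = ∀ {n} (φ : Fm n) → IsΣ k φ → ∀ (ρ : Vec V n) → All (_∈ M) ρ →
                 M ⊨ ⌜ φ ⌝ [ assignment ρ ] ⇔ V⊨ φ [ ρ ]

record LZFC {ℓ} (𝒱 : Structure ℓ) : Set ℓ where
  field
    bst : BST 𝒱
    loc : Internal.Loc-ZFC bst

record LZFCˢᵉˣᵗ {ℓ} (𝒱 : Structure ℓ) : Set ℓ where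
  field
    lzfc   : LZFC 𝒱
    locˢᵉˣᵗ : Internal.Locˢᵉˣᵗ-ZFC (LZFC.bst lzfc)

{-# OPTIONS --safe #-}

-- M-satisfaction of a standard formula is truth relativised to M, and bounded
-- formulas are absolute for transitive sets.  Any finite set of points of V lies
-- in some N with M ≺ N.  A universal statement true in M is true in every such N,
-- hence holds at every point of V; a Σ₂ statement true in V is true in any
-- such N that contains its witnesses (Π₁ truth goes down to N), hence in M.  No step
-- needs excluded middle.
module Submission where

open import Defs
open import Level using (Level)
open import Data.Empty using (⊥-elim)
open import Data.Fin using (Fin; zero; suc; toℕ; fromℕ; inject₁)
open import Data.Fin.Properties using (toℕ<n; toℕ-injective; toℕ-fromℕ; toℕ-inject₁)
open import Data.Fin.Relation.Unary.Top using (view; ‵fromℕ; ‵inject₁)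
open import Data.Nat using (ℕ; zero; suc; _<_)
open import Data.Nat.Properties using (<-cmp; m<1+n⇒m<n∨m≡n)
open import Data.Product using (∃-syntax; _×_; _,_; proj₁; proj₂)
open import Data.Product.Function.NonDependent.Propositional using (_×-⇔_)
open import Data.Sum using (_⊎_; inj₁; inj₂; [_,_]′)
open import Data.Sum.Function.Propositional using (_⊎-⇔_)
open import Data.Vec using (Vec; []; _∷_; lookup; init; last; initLast; _∷ʳ_)
open import Data.Vec.Relation.Unary.All as All using (All; []; _∷_)
open import Data.Vec.Relation.Unary.All.Properties using (lookup⁺)
open import Function.Base using (_∘_)
open import Function.Bundles using (_⇔_; mk⇔; Equivalence)
import Function.Properties.Equivalence as ⇔
open import Function.Related.TypeIsomorphisms using (→-cong-⇔; ¬-cong-⇔)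
open import Relation.Binary.Definitions using (tri<; tri≈; tri>)
open import Relation.Binary.PropositionalEquality
  using (_≡_; refl; sym; trans; cong; cong₂; subst; subst₂)
open import Relation.Nullary using (¬_)
open Equivalence using (to; from)
open Structure using (V)
open LZFC using (bst)
open LZFCˢᵉˣᵗ using (lzfc)
open Internal using (StronglyExtendible; Model; _≺Σ[_]V)

private variable
  a p : Level
  A : Set a
  n : ℕ

-- Vectors extended at the end, and the passage from Σ₁ to Σ₂.

lookup-∷ʳ-fromℕ : (xs : Vec A n) (x : A) → lookup (xs ∷ʳ x) (fromℕ n) ≡ x
lookup-∷ʳ-fromℕ []       x = refl
lookup-∷ʳ-fromℕ (_ ∷ xs) x = lookup-∷ʳ-fromℕ xs x

lookup-∷ʳ-inject₁ : (xs : Vec A n) (x : A) (i : Fin n) →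
                    lookup (xs ∷ʳ x) (inject₁ i) ≡ lookup xs i
lookup-∷ʳ-inject₁ (_ ∷ xs) x zero    = refl
lookup-∷ʳ-inject₁ (_ ∷ xs) x (suc i) = lookup-∷ʳ-inject₁ xs x i

All-∷ʳ : {P : A → Set p} {xs : Vec A n} {x : A} → All P xs → P x → All P (xs ∷ʳ x)
All-∷ʳ []         q = q ∷ []
All-∷ʳ (px ∷ pxs) q = px ∷ All-∷ʳ pxs q

-- The bounded matrix is read as a Π₁ formula with an empty universal block. This lets the Σ₁ claim
-- follow from the Σ₂ one.
IsΣ₁⇒IsΣ₂ : {φ : Fm n} → IsΣ 1 φ → IsΣ 2 φ
IsΣ₁⇒IsΣ₂ (fromΠ (bounded δ)) = fromΠ (fromΣ (bounded δ))
IsΣ₁⇒IsΣ₂ (∃-block σ)         = ∃-block (IsΣ₁⇒IsΣ₂ σ)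

module Elementarity {ℓ} {𝒱 : Structure ℓ} (B : BST 𝒱) where
  open Structure 𝒱 hiding (V)
  open Truth 𝒱
  open BST B
  open Internal B hiding (StronglyExtendible; Model; _≺Σ[_]V)

  -- Unordered pairs, unions and Kuratowski pairs.

  ∈-｛،｝ : ∀ {x y z} → z ∈ ｛ x ، y ｝ ⇔ (z ≡ x ⊎ z ≡ y)
  ∈-｛،｝ {x} {y} {z} = proj₂ (pair x y) z

  x∈｛x،y｝ : ∀ {x y} → x ∈ ｛ x ، y ｝
  x∈｛x،y｝ = from ∈-｛،｝ (inj₁ refl)

  y∈｛x،y｝ : ∀ {x y} → y ∈ ｛ x ، y ｝
  y∈｛x،y｝ = from ∈-｛،｝ (inj₂ refl)

  ∈-｛x،x｝ : ∀ {x z} → z ∈ ｛ x ، x ｝ → z ≡ x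
  ∈-｛x،x｝ z∈ = [ (λ e → e) , (λ e → e) ]′ (to ∈-｛،｝ z∈)

  ∈-∪ : ∀ {x y z} → z ∈ x ∪ y ⇔ (z ∈ x ⊎ z ∈ y)
  ∈-∪ {x} {y} {z} = mk⇔ f g
    where
    f : z ∈ x ∪ y → z ∈ x ⊎ z ∈ y
    f z∈ with to (proj₂ (union ｛ x ، y ｝) z) z∈
    ... | u , u∈ , z∈u = [ (λ { refl → inj₁ z∈u }) , (λ { refl → inj₂ z∈u }) ]′ (to ∈-｛،｝ u∈)
    g : z ∈ x ⊎ z ∈ y → z ∈ x ∪ y
    g (inj₁ z∈x) = from (proj₂ (union ｛ x ، y ｝) z) (x , x∈｛x،y｝ , z∈x)
    g (inj₂ z∈y) = from (proj₂ (union ｛ x ، y ｝) z) (y , y∈｛x،y｝ , z∈y)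

  -- Each of `y` and `z` lies in the other pair, so either they are identified directly or both
  -- equal `x`.
  ｛،｝-injectiveʳ : ∀ {x y z} → ｛ x ، y ｝ ≡ ｛ x ، z ｝ → y ≡ z
  ｛،｝-injectiveʳ {x} {y} {z} e
    with to ∈-｛،｝ (subst (y ∈_) e y∈｛x،y｝)
       | to ∈-｛،｝ (subst (z ∈_) (sym e) y∈｛x،y｝)
  ... | inj₂ y≡z | _        = y≡z
  ... | inj₁ y≡x | inj₁ z≡x = trans y≡x (sym z≡x)
  ... | inj₁ _   | inj₂ z≡y = sym z≡y

  ⟨،⟩-injective : ∀ {x y u v} → ⟨ x ، y ⟩ ≡ ⟨ u ، v ⟩ → x ≡ u × y ≡ v
  ⟨،⟩-injective {x} {y} {u} {v} e = x≡u , y≡v x≡u e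
    where
    x≡u : x ≡ u
    x≡u with to ∈-｛،｝ (subst (｛ x ، x ｝ ∈_) e x∈｛x،y｝)
    ... | inj₁ eq = ∈-｛x،x｝ (subst (x ∈_) eq x∈｛x،y｝)
    ... | inj₂ eq = sym (∈-｛x،x｝ (subst (u ∈_) (sym eq) x∈｛x،y｝))
    y≡v : x ≡ u → ⟨ x ، y ⟩ ≡ ⟨ u ، v ⟩ → y ≡ v
    -- With `u` replaced by `x`, both the outer pairs and then the inner ones share their left
    -- member, so right injectivity applies twice.
    y≡v refl = ｛،｝-injectiveʳ ∘ ｛،｝-injectiveʳ

  -- Von Neumann numerals.

  ∈-⁺ : ∀ {x z} → z ∈ x ⁺ ⇔ (z ∈ x ⊎ z ≡ x)
  ∈-⁺ = ⇔.trans ∈-∪ (⇔.refl ⊎-⇔ mk⇔ ∈-｛x،x｝ (λ { refl → x∈｛x،y｝ }))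

  numeral-∈ω : ∀ n → numeral n ∈ ω
  numeral-∈ω zero    = proj₁ (proj₁ (proj₂ omega)) ∅ (proj₂ emptySet)
  numeral-∈ω (suc n) = proj₂ (proj₁ (proj₂ omega)) _ _ (numeral-∈ω n) (λ _ → ∈-⁺)

  <⇒numeral-∈ : ∀ {m n} → m < n → numeral m ∈ numeral n
  <⇒numeral-∈ {n = suc n} m<1+n with m<1+n⇒m<n∨m≡n m<1+n
  ... | inj₁ m<n  = from ∈-⁺ (inj₁ (<⇒numeral-∈ m<n))
  ... | inj₂ refl = from ∈-⁺ (inj₂ refl)

  toℕ-numeral-∈ : (i : Fin n) → numeral (toℕ i) ∈ numeral n
  toℕ-numeral-∈ i = <⇒numeral-∈ (toℕ<n i)

  -- Even if `ω` is nonstandard, a standard numeral has only standard members. This lets an internal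
  -- index be replaced by a `Fin n`.
  ∈-numeral : ∀ n {z} → z ∈ numeral n → ∃[ i ] z ≡ numeral (toℕ {n} i)
  ∈-numeral zero    z∈∅ = ⊥-elim (proj₂ emptySet _ z∈∅)
  ∈-numeral (suc n) z∈  with to ∈-⁺ z∈
  ... | inj₂ z≡n = fromℕ n , trans z≡n (cong numeral (sym (toℕ-fromℕ n)))
  ... | inj₁ z∈n =
    let i , e = ∈-numeral n z∈n
    in inject₁ i , trans e (cong numeral (sym (toℕ-inject₁ i)))

  numeral-transitive : ∀ n → Transitive (numeral n)
  numeral-transitive zero    y y∈∅ = ⊥-elim (proj₂ emptySet y y∈∅)
  numeral-transitive (suc n) y y∈ z z∈y with to ∈-⁺ y∈
  ... | inj₁ y∈n  = from ∈-⁺ (inj₁ (numeral-transitive n y y∈n z z∈y))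
  ... | inj₂ refl = from ∈-⁺ (inj₁ z∈y)

  -- BST has no axiom of foundation, so irreflexivity comes from induction: by transitivity,
  -- `numeral (suc n)` inside itself would put `numeral n` inside itself.
  numeral-∉-numeral : ∀ n → ¬ numeral n ∈ numeral n
  numeral-∉-numeral zero    ∅∈∅ = proj₂ emptySet _ ∅∈∅
  numeral-∉-numeral (suc n) s∈s with to ∈-⁺ s∈s
  ... | inj₁ s∈n = numeral-∉-numeral n
                     (numeral-transitive n _ s∈n _ (from ∈-⁺ (inj₂ refl)))
  ... | inj₂ s≡n = numeral-∉-numeral n
                     (subst (numeral n ∈_) s≡n (from ∈-⁺ (inj₂ refl)))

  numeral-injective : ∀ {m n} → numeral m ≡ numeral n → m ≡ n
  numeral-injective {m} {n} e with <-cmp m n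
  ... | tri≈ _ m≡n _ = m≡n
  ... | tri< m<n _ _ =
    ⊥-elim (numeral-∉-numeral n (subst (_∈ numeral n) e (<⇒numeral-∈ m<n)))
  ... | tri> _ _ n<m =
    ⊥-elim (numeral-∉-numeral m (subst (_∈ numeral m) (sym e) (<⇒numeral-∈ n<m)))

  -- Coded assignments as graphs of vectors.

  entry : Vec (V 𝒱) n → Fin n → V 𝒱
  entry ρ i = ⟨ numeral (toℕ i) ، lookup ρ i ⟩

  -- Fixing only the members of `s` avoids having to identify `s ⌢[ numeral n ↦ x ]` with
  -- `assignment (ρ ∷ʳ x)`.
  record Represents (s : V 𝒱) (ρ : Vec (V 𝒱) n) : Set ℓ where
    constructor represents
    field
      ∈⇔entry : ∀ z → z ∈ s ⇔ (∃[ i ] z ≡ entry ρ i)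
  open Represents

  entry-∷ʳ-fromℕ : (ρ : Vec (V 𝒱) n) (x : V 𝒱) →
                   entry (ρ ∷ʳ x) (fromℕ n) ≡ ⟨ numeral n ، x ⟩
  entry-∷ʳ-fromℕ {n} ρ x =
    cong₂ ⟨_،_⟩ (cong numeral (toℕ-fromℕ n)) (lookup-∷ʳ-fromℕ ρ x)

  entry-∷ʳ-inject₁ : (ρ : Vec (V 𝒱) n) (x : V 𝒱) (i : Fin n) →
                     entry (ρ ∷ʳ x) (inject₁ i) ≡ entry ρ i
  entry-∷ʳ-inject₁ ρ x i =
    cong₂ ⟨_،_⟩ (cong numeral (toℕ-inject₁ i)) (lookup-∷ʳ-inject₁ ρ x i)

  Represents-⌢ : ∀ {s} {ρ : Vec (V 𝒱) n} x → Represents s ρ →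
                 Represents (s ⌢[ numeral n ↦ x ]) (ρ ∷ʳ x)
  Represents-⌢ {n} {s} {ρ} x r = represents λ z → mk⇔ (f z) (g z)
    where
    f : ∀ z → z ∈ s ⌢[ numeral n ↦ x ] → ∃[ i ] z ≡ entry (ρ ∷ʳ x) i
    f z z∈ with to ∈-∪ z∈
    ... | inj₁ z∈s = let i , e = to (∈⇔entry r z) z∈s
                     in inject₁ i , trans e (sym (entry-∷ʳ-inject₁ ρ x i))
    ... | inj₂ z∈p = fromℕ n , trans (∈-｛x،x｝ z∈p) (sym (entry-∷ʳ-fromℕ ρ x))
    g : ∀ z → (∃[ i ] z ≡ entry (ρ ∷ʳ x) i) → z ∈ s ⌢[ numeral n ↦ x ]
    g z (i , e) with view i
    ... | ‵fromℕ     = from ∈-∪ (inj₂ (subst (_∈ _)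
                         (sym (trans e (entry-∷ʳ-fromℕ ρ x))) x∈｛x،y｝))
    ... | ‵inject₁ j = from ∈-∪ (inj₁ (from (∈⇔entry r z)
                         (j , trans e (entry-∷ʳ-inject₁ ρ x j))))

  Represents-assignment : (ρ : Vec (V 𝒱) n) → Represents (assignment ρ) ρ
  Represents-assignment {zero}  [] =
    represents λ z → mk⇔ (λ z∈∅ → ⊥-elim (proj₂ emptySet z z∈∅)) λ ()
  Represents-assignment {suc n} ρ  =
    -- `assignment` recurses through `init` and `last`, so `ρ` is first rewritten as
    -- `init ρ ∷ʳ last ρ`.
    subst (Represents (assignment ρ)) (sym (proj₂ (proj₂ (initLast ρ))))
      (Represents-⌢ (last ρ) (Represents-assignment (init ρ)))

  -- Distinct standard indices have distinct numerals, so no two entries compete for one index.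
  Represents-functional : ∀ {s} {ρ : Vec (V 𝒱) n} → Represents s ρ →
                          ∀ i {y} → ⟨ numeral (toℕ i) ، y ⟩ ∈ s → y ≡ lookup ρ i
  Represents-functional {ρ = ρ} r i p∈s =
    let j , e     = to (∈⇔entry r _) p∈s
        i≡j , y≡ρ = ⟨،⟩-injective e
    in trans y≡ρ (cong (lookup ρ) (sym (toℕ-injective (numeral-injective i≡j))))

  Represents⇒IsAssignment : ∀ {s M} {ρ : Vec (V 𝒱) n} → Represents s ρ →
                            All (_∈ M) ρ → IsAssignment s (numeral n) M
  Represents⇒IsAssignment {n} {s} {M} {ρ} r ρ∈M = entries , values
    where
    entries : ∀ z → z ∈ s → ∃[ i ] ∃[ x ] (i ∈ numeral n × x ∈ M × z ≡ ⟨ i ، x ⟩)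
    entries z z∈s = let i , e = to (∈⇔entry r z) z∈s
                    in _ , _ , toℕ-numeral-∈ i , lookup⁺ ρ∈M i , e
    values : ∀ i → i ∈ numeral n → ∃[ x ] (⟨ i ، x ⟩ ∈ s × (∀ y → ⟨ i ، y ⟩ ∈ s → y ≡ x))
    values i i∈n with ∈-numeral n i∈n
    ... | j , refl = lookup ρ j , from (∈⇔entry r _) (j , refl) , λ _ → Represents-functional r j

  -- Internal satisfaction of standard formulas.

  Form-⌜⌝ : (φ : Fm n) → Form (numeral n) ⌜ φ ⌝
  Form-⌜⌝ {n} φ F closed = go φ
    where
    open FormulaClosed closed
    go : ∀ {n} (φ : Fm n) → ⟨ numeral n ، ⌜ φ ⌝ ⟩ ∈ F
    go {n} (i ∈̇ j)  = mem _ (numeral-∈ω n) _ _ (toℕ-numeral-∈ i) (toℕ-numeral-∈ j)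
    go {n} (i ≐ j)   = eq _ (numeral-∈ω n) _ _ (toℕ-numeral-∈ i) (toℕ-numeral-∈ j)
    go {n} (¬̇ φ)    = neg _ (numeral-∈ω n) _ (go φ)
    go {n} (φ ∧̇ ψ)  = and _ (numeral-∈ω n) _ _ (go φ) (go ψ)
    go {n} (φ ∨̇ ψ)  = or _ (numeral-∈ω n) _ _ (go φ) (go ψ)
    go {n} (φ ⇒̇ ψ)  = imp _ (numeral-∈ω n) _ _ (go φ) (go ψ)
    go {n} (∀̇ φ)    = all _ (numeral-∈ω n) _ (go φ)
    -- As for `∀̇`, the closure rule fits because `numeral (suc n)` unfolds to `numeral n ⁺`.
    go {n} (∃̇ φ)    = ex _ (numeral-∈ω n) _ (go φ)

  -- The relativisation of `φ` to `M`, computed by recursion outside the structure; it mentions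
  -- neither codes nor a satisfaction relation.
  _⊩_[_] : V 𝒱 → Fm n → Vec (V 𝒱) n → Set ℓ
  M ⊩ i ∈̇ j [ ρ ]  = lookup ρ i ∈ lookup ρ j
  M ⊩ i ≐ j [ ρ ]   = lookup ρ i ≡ lookup ρ j
  M ⊩ ¬̇ φ [ ρ ]    = ¬ M ⊩ φ [ ρ ]
  M ⊩ φ ∧̇ ψ [ ρ ]  = M ⊩ φ [ ρ ] × M ⊩ ψ [ ρ ]
  M ⊩ φ ∨̇ ψ [ ρ ]  = M ⊩ φ [ ρ ] ⊎ M ⊩ ψ [ ρ ]
  M ⊩ φ ⇒̇ ψ [ ρ ]  = M ⊩ φ [ ρ ] → M ⊩ ψ [ ρ ]
  M ⊩ ∀̇ φ [ ρ ]    = ∀ x → x ∈ M → M ⊩ φ [ ρ ∷ʳ x ]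
  M ⊩ ∃̇ φ [ ρ ]    = ∃[ x ] (x ∈ M × M ⊩ φ [ ρ ∷ʳ x ])

  module _ {M S : V 𝒱} (sat : IsSatisfaction M S) where
    open IsSatisfaction sat

    entries⇔lookup : ∀ {s} {ρ : Vec (V 𝒱) n} → Represents s ρ →
      (R : V 𝒱 → V 𝒱 → Set ℓ) (i j : Fin n) →
      (∃[ x ] ∃[ y ] (⟨ numeral (toℕ i) ، x ⟩ ∈ s × ⟨ numeral (toℕ j) ، y ⟩ ∈ s × R x y))
        ⇔ R (lookup ρ i) (lookup ρ j)
    entries⇔lookup r R i j = mk⇔
      (λ { (x , y , x∈ , y∈ , Rxy) →
             subst₂ R (Represents-functional r i x∈) (Represents-functional r j y∈) Rxy })
      (λ Rxy → _ , _ , from (∈⇔entry r _) (i , refl) , from (∈⇔entry r _) (j , refl) , Rxy)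

    -- Induction on `φ` matches each satisfaction clause with the relativised one. Connectives keep
    -- `s` and `ρ` fixed; only quantifiers extend both. As `S` is arbitrary, all satisfaction
    -- relations for `M` agree on standard formulas.
    ∈S⇔⊩ : ∀ {s} {ρ : Vec (V 𝒱) n} → Represents s ρ → All (_∈ M) ρ → (φ : Fm n) →
           ⟨ ⌜ φ ⌝ ، s ⟩ ∈ S ⇔ M ⊩ φ [ ρ ]
    ∈S⇔⊩ {n} {s} {ρ} r ρ∈M = go
      where
      n∈ω : numeral n ∈ ω
      n∈ω = numeral-∈ω n
      s∈ⁿM : IsAssignment s (numeral n) M
      s∈ⁿM = Represents⇒IsAssignment r ρ∈M
      go : (φ : Fm n) → ⟨ ⌜ φ ⌝ ، s ⟩ ∈ S ⇔ M ⊩ φ [ ρ ]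
      go (i ∈̇ j)  = ⇔.trans
        (mem _ n∈ω s s∈ⁿM _ _ (toℕ-numeral-∈ i) (toℕ-numeral-∈ j)) (entries⇔lookup r _∈_ i j)
      go (i ≐ j)  = ⇔.trans
        (eq _ n∈ω s s∈ⁿM _ _ (toℕ-numeral-∈ i) (toℕ-numeral-∈ j)) (entries⇔lookup r _≡_ i j)
      go (¬̇ φ)   = ⇔.trans (neg _ n∈ω s s∈ⁿM _ (Form-⌜⌝ φ)) (¬-cong-⇔ (go φ))
      go (φ ∧̇ ψ) = ⇔.trans
        (and _ n∈ω s s∈ⁿM _ _ (Form-⌜⌝ φ) (Form-⌜⌝ ψ)) (go φ ×-⇔ go ψ)
      go (φ ∨̇ ψ) = ⇔.trans
        (or _ n∈ω s s∈ⁿM _ _ (Form-⌜⌝ φ) (Form-⌜⌝ ψ)) (go φ ⊎-⇔ go ψ)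
      go (φ ⇒̇ ψ) = ⇔.trans
        (imp _ n∈ω s s∈ⁿM _ _ (Form-⌜⌝ φ) (Form-⌜⌝ ψ)) (→-cong-⇔ (go φ) (go ψ))
      go (∀̇ φ)   = ⇔.trans (all _ n∈ω s s∈ⁿM _ (Form-⌜⌝ φ)) (mk⇔
        (λ h x x∈M → to (∈S⇔⊩ (Represents-⌢ x r) (All-∷ʳ ρ∈M x∈M) φ) (h x x∈M))
        (λ h x x∈M → from (∈S⇔⊩ (Represents-⌢ x r) (All-∷ʳ ρ∈M x∈M) φ) (h x x∈M)))
      go (∃̇ φ)   = ⇔.trans (ex _ n∈ω s s∈ⁿM _ (Form-⌜⌝ φ)) (mk⇔
        (λ { (x , x∈M , h) →
               x , x∈M , to (∈S⇔⊩ (Represents-⌢ x r) (All-∷ʳ ρ∈M x∈M) φ) h })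
        (λ { (x , x∈M , h) →
               x , x∈M , from (∈S⇔⊩ (Represents-⌢ x r) (All-∷ʳ ρ∈M x∈M) φ) h }))

  ⊨⇔⊩ : ∀ {M} → Model B M → {ρ : Vec (V 𝒱) n} → All (_∈ M) ρ → (φ : Fm n) →
        M ⊨ ⌜ φ ⌝ [ assignment ρ ] ⇔ M ⊩ φ [ ρ ]
  ⊨⇔⊩ (_ , S , satS , _) {ρ} ρ∈M φ = mk⇔
    -- The truth may be witnessed by any `S′`; conversely the satisfaction relation that comes with
    -- the model serves as witness.
    (λ { (S′ , satS′ , φ∈S′) → to (∈S⇔⊩ satS′ (Represents-assignment ρ) ρ∈M φ) φ∈S′ })
    (λ h → S , satS , from (∈S⇔⊩ satS (Represents-assignment ρ) ρ∈M φ) h)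

  ≺⇒⊩⇔⊩ : ∀ {M N} → Model B M → Model B N → M ≺ N →
          {ρ : Vec (V 𝒱) n} → All (_∈ M) ρ → (φ : Fm n) → M ⊩ φ [ ρ ] ⇔ N ⊩ φ [ ρ ]
  ≺⇒⊩⇔⊩ {n} modM modN (M⊆N , elem) {ρ} ρ∈M φ =
    ⇔.trans (⇔.sym (⊨⇔⊩ modM ρ∈M φ))
      (⇔.trans
        (elem _ (numeral-∈ω n) _ (Form-⌜⌝ φ) _
          (Represents⇒IsAssignment (Represents-assignment ρ) ρ∈M))
        (⊨⇔⊩ modN (All.map (M⊆N _) ρ∈M) φ))

  -- Absoluteness of bounded formulas.

  bounded-∈ : ∀ {N x} → Transitive N → (i : Fin n) {ρ : Vec (V 𝒱) n} → All (_∈ N) ρ →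
              lookup (ρ ∷ʳ x) (fromℕ n) ∈ lookup (ρ ∷ʳ x) (inject₁ i) → x ∈ N
  bounded-∈ {x = x} tr i {ρ} ρ∈N x∈ρi = tr _ (lookup⁺ ρ∈N i) x
    (subst₂ _∈_ (lookup-∷ʳ-fromℕ ρ x) (lookup-∷ʳ-inject₁ ρ x i) x∈ρi)

  -- A bounded quantifier ranges over a member of `N`, and by transitivity everything in that member
  -- is again in `N`.
  Δ₀-absolute : ∀ {N} → Transitive N → {φ : Fm n} → Δ₀ φ →
                {ρ : Vec (V 𝒱) n} → All (_∈ N) ρ → N ⊩ φ [ ρ ] ⇔ V⊨ φ [ ρ ]
  Δ₀-absolute tr (mem₀ i j)  ρ∈N = ⇔.refl
  Δ₀-absolute tr (eq₀ i j)   ρ∈N = ⇔.refl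
  Δ₀-absolute tr (neg₀ δ)    ρ∈N = ¬-cong-⇔ (Δ₀-absolute tr δ ρ∈N)
  Δ₀-absolute tr (and₀ δ ε)  ρ∈N = Δ₀-absolute tr δ ρ∈N ×-⇔ Δ₀-absolute tr ε ρ∈N
  Δ₀-absolute tr (or₀ δ ε)   ρ∈N = Δ₀-absolute tr δ ρ∈N ⊎-⇔ Δ₀-absolute tr ε ρ∈N
  Δ₀-absolute tr (imp₀ δ ε)  ρ∈N = →-cong-⇔ (Δ₀-absolute tr δ ρ∈N) (Δ₀-absolute tr ε ρ∈N)
  Δ₀-absolute tr (ball₀ i δ) ρ∈N = mk⇔
    (λ h x x∈ρi → let x∈N = bounded-∈ tr i ρ∈N x∈ρi in
      to (Δ₀-absolute tr δ (All-∷ʳ ρ∈N x∈N)) (h x x∈N x∈ρi))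
    (λ h x x∈N x∈ρi → from (Δ₀-absolute tr δ (All-∷ʳ ρ∈N x∈N)) (h x x∈ρi))
  Δ₀-absolute tr (bex₀ i δ) ρ∈N = mk⇔
    (λ { (x , x∈N , x∈ρi , h) → x , x∈ρi , to (Δ₀-absolute tr δ (All-∷ʳ ρ∈N x∈N)) h })
    (λ { (x , x∈ρi , h) → let x∈N = bounded-∈ tr i ρ∈N x∈ρi in
      x , x∈N , x∈ρi , from (Δ₀-absolute tr δ (All-∷ʳ ρ∈N x∈N)) h })

  -- Transfer of Π₁ and Σ₂ truth.

  Π₁-downward : ∀ {N} → Transitive N → {φ : Fm n} → IsΠ 1 φ →
                {ρ : Vec (V 𝒱) n} → All (_∈ N) ρ → V⊨ φ [ ρ ] → N ⊩ φ [ ρ ]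
  Π₁-downward tr (fromΣ (bounded δ)) ρ∈N h         = from (Δ₀-absolute tr δ ρ∈N) h
  Π₁-downward tr (∀-block π)         ρ∈N h x x∈N =
    Π₁-downward tr π (All-∷ʳ ρ∈N x∈N) (h x)

  -- The hypothesis asks for models around every w, so that the value of each
  -- universal quantifier can be put into w.
  Π₁-upward : {φ : Fm n} → IsΠ 1 φ → {ρ : Vec (V 𝒱) n} →
    (∀ w → ∃[ N ] (Transitive N × w ∈ N × All (_∈ N) ρ × N ⊩ φ [ ρ ])) → V⊨ φ [ ρ ]
  Π₁-upward (fromΣ (bounded δ)) h =
    let N , tr , _ , ρ∈N , hN = h ∅ in to (Δ₀-absolute tr δ ρ∈N) hN
  Π₁-upward (∀-block π) h x = Π₁-upward π λ w →
    let N , tr , p∈N , ρ∈N , hN = h ｛ w ، x ｝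
        x∈N = tr _ p∈N x y∈｛x،y｝
    in N , tr , tr _ p∈N w x∈｛x،y｝ , All-∷ʳ ρ∈N x∈N , hN x x∈N

  -- Nested unordered pairs pack the existential witnesses into `w`. A transitive `N` containing `w`
  -- contains them all, and the remaining Π₁ kernel passes down to `N`.
  Σ₂-reflection : {φ : Fm n} → IsΣ 2 φ → {ρ : Vec (V 𝒱) n} → V⊨ φ [ ρ ] →
    ∃[ w ] (∀ N → Transitive N → w ∈ N → All (_∈ N) ρ → N ⊩ φ [ ρ ])
  -- With no witness left to pack, `∅` is a mere starting value.
  Σ₂-reflection (fromΠ π)   h       = ∅ , λ N tr _ ρ∈N → Π₁-downward tr π ρ∈N h
  Σ₂-reflection (∃-block σ) (x , h) =
    let w , reflect = Σ₂-reflection σ h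
    in ｛ w ، x ｝ , λ N tr p∈N ρ∈N →
         let x∈N = tr _ p∈N x y∈｛x،y｝
         in x , x∈N , reflect N tr (tr _ p∈N w x∈｛x،y｝) (All-∷ʳ ρ∈N x∈N)

  -- Witnesses found in `M` are already points of the universe, so only the Π₁ kernel has to move.
  -- Elementarity carries it to an extension around any `w`, as `Π₁-upward` requires.
  Σ₂-upward : ∀ {M} → StronglyExtendible B M → {φ : Fm n} → IsΣ 2 φ →
              {ρ : Vec (V 𝒱) n} → All (_∈ M) ρ → M ⊩ φ [ ρ ] → V⊨ φ [ ρ ]
  Σ₂-upward (modM , ext) (fromΠ {φ = φ} π) ρ∈M h = Π₁-upward π λ w →
    let N , modN , w∈N , M≺N = ext w
    in N , proj₁ modN , w∈N , All.map (proj₁ M≺N _) ρ∈M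
         , to (≺⇒⊩⇔⊩ modM modN M≺N ρ∈M φ) h
  Σ₂-upward sext (∃-block σ) ρ∈M (x , x∈M , h) =
    x , Σ₂-upward sext σ (All-∷ʳ ρ∈M x∈M) h

  stronglyExtendible⇒≺Σ₂V : ∀ {M} → StronglyExtendible B M → _≺Σ[_]V B M 2
  stronglyExtendible⇒≺Σ₂V {M} sext@(modM , ext) φ σ ρ ρ∈M =
    ⇔.trans (⊨⇔⊩ modM ρ∈M φ) (mk⇔ (Σ₂-upward sext σ ρ∈M) downward)
    where
    downward : V⊨ φ [ ρ ] → M ⊩ φ [ ρ ]
    downward h =
      -- The witnesses are packed first, and the extension `N` is then chosen around them; the
      -- parameters reach `N` through `M`.
      let w , reflect = Σ₂-reflection σ h
          N , modN , w∈N , M≺N = ext w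
      in from (≺⇒⊩⇔⊩ modM modN M≺N ρ∈M φ)
           (reflect N (proj₁ modN) w∈N (All.map (proj₁ M≺N _) ρ∈M))

  stronglyExtendible⇒≺Σ₁V : ∀ {M} → StronglyExtendible B M → _≺Σ[_]V B M 1
  stronglyExtendible⇒≺Σ₁V sext φ σ = stronglyExtendible⇒≺Σ₂V sext φ (IsΣ₁⇒IsΣ₂ σ)

open Elementarity using (stronglyExtendible⇒≺Σ₁V; stronglyExtendible⇒≺Σ₂V)

lemma3p9 : ∀ {ℓ : Level} (𝒱 : Structure ℓ) →
    ((T : LZFC 𝒱) (M : V 𝒱) → StronglyExtendible (bst T) M →
    _≺Σ[_]V (bst T) M 1)
    × ((T : LZFCˢᵉˣᵗ 𝒱) (x : V 𝒱) →
    ∃[ M ] (Structure._∈_ 𝒱 x M × Model (bst (lzfc T)) M × _≺Σ[_]V (bst (lzfc T)) M 1))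
    × ((T : LZFC 𝒱) (M : V 𝒱) → StronglyExtendible (bst T) M →
    _≺Σ[_]V (bst T) M 2)
lemma3p9 𝒱 =
    (λ T M → stronglyExtendible⇒≺Σ₁V (bst T))
  , (λ T x → let M , sext , x∈M = LZFCˢᵉˣᵗ.locˢᵉˣᵗ T x
             in M , x∈M , proj₁ sext , stronglyExtendible⇒≺Σ₁V (bst (lzfc T)) sext)
  , (λ T M → stronglyExtendible⇒≺Σ₂V (bst T))
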